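{- Algorithm Greedy-MHV is a $1/k$-approximation algorithm for the MHV problem, where $k$ is the number of colors given in the input. That is, it runs in polynomial time and, on every instance, outputs a total vertex coloring extending the given partial coloring whose number of happy vertices is at least $\frac{1}{k}\cdot OPT$, where $OPT$ is the maximum number of happy vertices over all total colorings extending the given partial coloring.
   Context: Maximum Happy Vertices problem (MHV): an instance consists of an undirected graph $G=(V,E)$, a color set $C=\{1,2,\ldots,k\}$ ($k$ is part of the input), and a partial vertex coloring $c\colon V\to C$ (i.e. $c$ assigns colors to only part of the vertices). A total vertex coloring $c'\colon V\to C$ extends $c$ if it agrees with $c$ wherever $c$ is defined. Under a total coloring, a vertex is happy if it has the same color as all of its neighbors, and unhappy otherwise. The task is to find a total coloring extending $c$ that maximizes the number of happy vertices. Algorithm Greedy-MHV: for each color $i\in\{1,\ldots,k\}$, form the total coloring obtained by giving color $i$ to every vertex left uncolored by $c$; among the $k$ total colorings so obtained, output one having the largest number of happy vertices. -}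

module Defs where

open import Data.Bool using (Bool; _∧_; T; T?; if_then_else_)
open import Data.Fin using (Fin; zero; suc; toℕ)
import Data.Fin.Properties as Fin
open import Data.Integer using (+_)
open import Data.List using (List; []; _∷_; length; filter; allFin)
open import Data.Maybe using (Maybe; just; nothing; fromMaybe; maybe′)
open import Data.Nat using (ℕ; zero; suc; _+_; _*_; _≤_; NonZero; _≡ᵇ_; _≤ᵇ_)
open import Data.Product using (∃-syntax; _×_)
open import Data.Rational as ℚ using (ℚ)
open import Relation.Binary.PropositionalEquality using (_≡_; _≗_)
open import Relation.Nullary using (¬_; Dec)
open import Relation.Nullary.Decidable using (_→-dec_)

------------------------------------------------------------------------
-- The problem

record Graph (n : ℕ) : Set where
  field
    adj    : Fin n → Fin n → Bool
    sym    : ∀ {u v} → T (adj u v) → T (adj v u)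
    irrefl : ∀ {v} → ¬ T (adj v v)

Colouring : ℕ → ℕ → Set
Colouring n k = Fin n → Fin k

-- The colours 1, …, k are the elements of Fin k.  There is at least one of
-- them, as otherwise the ratio 1/k has no meaning.
record Instance : Set where
  field
    n k            : ℕ
    {{k-nonZero}}  : NonZero k
    graph          : Graph n
    partial        : Fin n → Maybe (Fin k)

  open Graph graph public

open Instance

TotalColouring : Instance → Set
TotalColouring I = Colouring (n I) (k I)

Extends : (I : Instance) → TotalColouring I → Set
Extends I c′ = ∀ v i → partial I v ≡ just i → c′ v ≡ i

Happy : (I : Instance) → TotalColouring I → Fin (n I) → Set
Happy I c′ u = ∀ v → T (adj I u v) → c′ u ≡ c′ v

happy? : (I : Instance) (c′ : TotalColouring I) → ∀ u → Dec (Happy I c′ u)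
happy? I c′ u = Fin.all? λ v → T? (adj I u v) →-dec (c′ u Fin.≟ c′ v)

#happy : (I : Instance) → TotalColouring I → ℕ
#happy I c′ = length (filter (happy? I c′) (allFin (n I)))

IsOPT : Instance → ℕ → Set
IsOPT I m =
  (∃[ c′ ] Extends I c′ × #happy I c′ ≡ m) ×
  (∀ c′ → Extends I c′ → #happy I c′ ≤ m)

-- c′ extends the given partial colouring and has at least ρ · OPT happy
-- vertices.
IsApproximateSolution : (I : Instance) → ℚ → TotalColouring I → Set
IsApproximateSolution I ρ c′ =
  Extends I c′ ×
  (∃[ opt ] IsOPT I opt × ρ ℚ.* (+ opt ℚ./ 1) ℚ.≤ (+ #happy I c′ ℚ./ 1))

fill : (I : Instance) → Fin (k I) → TotalColouring I
fill I i v = fromMaybe i (partial I v)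

-- The admissible outputs of Greedy-MHV; how ties are broken is left open.
IsGreedyOutput : (I : Instance) → TotalColouring I → Set
IsGreedyOutput I c′ =
  ∃[ i ] c′ ≗ fill I i × (∀ j → #happy I (fill I j) ≤ #happy I (fill I i))

------------------------------------------------------------------------
-- A machine model in which running time is measured: structured programs
-- over two-dimensional arrays of natural numbers, with unit cost per
-- operation.  As the only arithmetic operation is the successor, no number
-- ever exceeds the largest input number or literal by more than the time
-- used, so that unit cost agrees with bit cost up to a polynomial.

-- The value of the array named a at position (x , y) is σ a x y.
Store : Set
Store = ℕ → ℕ → ℕ → ℕ

infix  9 _[_,_] _[_]
infix  7 _==_ _<=_
infix  6 _[_,_]:=_ _[_]:=_ _:=_
infixr 5 If_Then_Else_ For_<_Do_
infixr 4 _⨾_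

data Expr : Set where
  lit     : ℕ → Expr
  succ    : Expr → Expr
  _[_,_]  : ℕ → Expr → Expr → Expr

data Test : Set where
  _==_ _<=_ : Expr → Expr → Test

-- For x < e Do p evaluates e once, to m say, and then runs p with x set to
-- 0, 1, …, m - 1 in turn.
data Program : Set where
  skip           : Program
  _[_,_]:=_      : ℕ → Expr → Expr → Expr → Program
  _⨾_            : Program → Program → Program
  If_Then_Else_  : Test → Program → Program → Program
  For_<_Do_      : ℕ → Expr → Program → Program

⟦_⟧ : Expr → Store → ℕ
⟦ lit m ⟧       σ = m
⟦ succ e ⟧      σ = suc (⟦ e ⟧ σ)
⟦ a [ d , e ] ⟧ σ = σ a (⟦ d ⟧ σ) (⟦ e ⟧ σ)

⟦_⟧ᵗ : Test → Store → Bool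
⟦ d == e ⟧ᵗ σ = ⟦ d ⟧ σ ≡ᵇ ⟦ e ⟧ σ
⟦ d <= e ⟧ᵗ σ = ⟦ d ⟧ σ ≤ᵇ ⟦ e ⟧ σ

write : ℕ → ℕ → ℕ → ℕ → Store → Store
write a x y m σ b x′ y′ =
  if (a ≡ᵇ b) ∧ (x ≡ᵇ x′) ∧ (y ≡ᵇ y′) then m else σ b x′ y′

-- A scalar variable is the entry (0 , 0) of its array, and a
-- one-dimensional array consists of the entries (x , 0).
setVar : ℕ → ℕ → Store → Store
setVar x = write x 0 0

iterate : ℕ → (ℕ → Store → Store) → Store → Store
iterate zero    f σ = σ
iterate (suc m) f σ = f m (iterate m f σ)

run : Program → Store → Store
run skip                  σ = σ
run (a [ d , e ]:= e′)    σ = write a (⟦ d ⟧ σ) (⟦ e ⟧ σ) (⟦ e′ ⟧ σ) σ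
run (p ⨾ q)               σ = run q (run p σ)
run (If t Then p Else q)  σ = if ⟦ t ⟧ᵗ σ then run p σ else run q σ
run (For x < e Do p)      σ =
  iterate (⟦ e ⟧ σ) (λ i τ → run p (setVar x i τ)) σ

exprTime : Expr → ℕ
exprTime (lit m)       = 1
exprTime (succ e)      = 1 + exprTime e
exprTime (a [ d , e ]) = 1 + exprTime d + exprTime e

testTime : Test → ℕ
testTime (d == e) = 1 + exprTime d + exprTime e
testTime (d <= e) = 1 + exprTime d + exprTime e

sumBelow : ℕ → (ℕ → ℕ) → ℕ
sumBelow zero    f = 0
sumBelow (suc m) f = sumBelow m f + f m

time : Program → Store → ℕ
time skip                  σ = 1
time (a [ d , e ]:= e′)    σ = 1 + exprTime d + exprTime e + exprTime e′
time (p ⨾ q)               σ = time p σ + time q (run p σ)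
time (If t Then p Else q)  σ =
  testTime t + (if ⟦ t ⟧ᵗ σ then time p σ else time q σ)
time (For x < e Do p)      σ =
  1 + exprTime e +
  sumBelow (⟦ e ⟧ σ) λ i →
    1 + time p (setVar x i (iterate i (λ j τ → run p (setVar x j τ)) σ))

var : ℕ → Expr
var x = x [ lit 0 , lit 0 ]

_:=_ : ℕ → Expr → Program
x := e = x [ lit 0 , lit 0 ]:= e

_[_] : ℕ → Expr → Expr
a [ e ] = a [ e , lit 0 ]

_[_]:=_ : ℕ → Expr → Expr → Program
a [ d ]:= e = a [ d , lit 0 ]:= e

------------------------------------------------------------------------
-- Programs for MHV

pattern N   = 0
pattern K   = 1
pattern ADJ = 2
pattern COL = 3
pattern OUT = 4

colourCode : ∀ {k} → Fin k → ℕ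
colourCode i = suc (toℕ i)

-- f as an array, with entries 0 outside its range.
array : ∀ {n} → (Fin n → ℕ) → ℕ → ℕ
array {zero}  f x       = 0
array {suc n} f zero    = f zero
array {suc n} f (suc x) = array (λ v → f (suc v)) x

-- Colour codes are 1, …, k, and 0 stands for an uncoloured vertex.  All
-- entries of the store not describing the input are 0.
encode : Instance → Store
encode I N   0 0 = n I
encode I K   0 0 = k I
encode I ADJ x y = array (λ u → array (λ v → if adj I u v then 1 else 0) y) x
encode I COL x 0 = array (λ v → maybe′ colourCode 0 (partial I v)) x
encode I _   _ _ = 0

Outputs : Program → (I : Instance) → TotalColouring I → Set
Outputs p I c′ = ∀ v → run p (encode I) OUT (toℕ v) 0 ≡ colourCode (c′ v)

-- The polynomial with the given coefficients, constant term first.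
evalPoly : List ℕ → ℕ → ℕ
evalPoly []       x = 0
evalPoly (a ∷ as) x = a + x * evalPoly as x

-- An explicit encoding of the graph and of the list of colours has length
-- at least n + k, and at most polynomial in n + k.
size : Instance → ℕ
size I = n I + k I

RunsInPolynomialTime : Program → Set
RunsInPolynomialTime p =
  ∃[ as ] (∀ I → time p (encode I) ≤ evalPoly as (size I))

IsApproximationAlgorithm : (Instance → ℚ) → Program → Set
IsApproximationAlgorithm ρ p =
  RunsInPolynomialTime p ×
  (∀ I → ∃[ c′ ] Outputs p I c′ × IsApproximateSolution I (ρ I) c′)

1/k : Instance → ℚ
1/k I = + 1 ℚ./ k I

------------------------------------------------------------------------
-- Greedy-MHV

pattern CUR        = 5
pattern BEST       = 6
pattern BESTCOLOUR = 7
pattern COUNT      = 8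
pattern FLAG       = 9
pattern I′         = 10
pattern U          = 11
pattern W          = 12

-- Writes to dst the given partial colouring, with the colour whose code is
-- one more than the value of e given to every uncoloured vertex.
fillInto : ℕ → Expr → Program
fillInto dst e =
  For U < var N Do
    If COL [ var U ] == lit 0
    Then dst [ var U ]:= succ e
    Else dst [ var U ]:= COL [ var U ]

-- Sets COUNT to the number of happy vertices of the colouring CUR.
countHappy : Program
countHappy =
  COUNT := lit 0 ⨾
  For U < var N Do
    (FLAG := lit 1 ⨾
     (For W < var N Do
       If ADJ [ var U , var W ] == lit 1
       Then (If CUR [ var U ] == CUR [ var W ]
             Then skip
             Else FLAG := lit 0)
       Else skip) ⨾
     (If var FLAG == lit 1
      Then COUNT := succ (var COUNT)
      Else skip))

greedyMHV : Program
greedyMHV =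
  BEST := lit 0 ⨾
  BESTCOLOUR := lit 0 ⨾
  (For I′ < var K Do
    (fillInto CUR (var I′) ⨾
     countHappy ⨾
     (If var BEST <= var COUNT
      Then (BEST := var COUNT ⨾
            BESTCOLOUR := var I′)
      Else skip))) ⨾
  fillInto OUT (var BESTCOLOUR)

{-# OPTIONS --safe #-}

-- A vertex u that is happy under a colouring c extending the partial one stays
-- happy under fill i for i = c u: the vertices of its closed neighbourhood
-- either have the given colour i or are uncoloured.  Hence OPT is at most the
-- sum of the numbers of happy vertices of the k colourings fill i, and so at
-- most k times the largest of them.

module Submission where

open import Data.Bool using (Bool; true; false; T; T?; not; _∧_; _∨_; if_then_else_)
open import Data.Bool.Properties using (T-∧)
open import Data.Empty using (⊥-elim)
open import Data.Fin using (Fin; zero; suc; toℕ; fromℕ<; finToFun; funToFin)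
import Data.Fin.Properties as Fin
open import Data.Integer as ℤ using (+≤+)
import Data.Integer.Properties as ℤ
open import Data.List using (List; []; _∷_; length; filter; allFin; map; tabulate)
open import Data.List.Extrema.Nat using (argmax; f[xs]≤f[argmax])
open import Data.List.Membership.Propositional.Properties using (∈-map⁺; ∈-allFin)
open import Data.List.Properties using (filter-≐)
import Data.List.Relation.Unary.All as All
open import Data.Maybe using (just; nothing; fromMaybe; maybe′)
open import Data.Nat
open import Data.Nat.Properties
open import Algebra.Properties.CommutativeSemigroup +-commutativeSemigroup using (interchange)
open import Data.Product using (_×_; _,_; proj₁; proj₂; ∃-syntax)
open import Data.Rational as ℚ using ()
import Data.Rational.Properties as ℚ
open import Data.Rational.Unnormalised as ℚᵘ using (mkℚᵘ; *≤*)
import Data.Rational.Unnormalised.Properties as ℚᵘ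
open import Data.Sum using (_⊎_; inj₁; inj₂; [_,_]′)
open import Data.Unit using (⊤)
open import Function using (_∘_; id; _⇔_; mk⇔; const; Equivalence)
open import Relation.Binary.PropositionalEquality
  using (_≡_; _≗_; refl; sym; trans; cong; cong₂; subst; subst₂; module ≡-Reasoning)
open import Relation.Nullary using (yes; no; does; contradiction)
open import Relation.Nullary.Decidable using (does-⇔)
open import Relation.Unary using (Decidable)
open import Defs

open Instance using (n; k; partial; adj)

-- Happy vertices and the approximation ratio

module _ {A : Set} where

  filter-∪ : ∀ {P Q R : A → Set} (P? : Decidable P) (Q? : Decidable Q) (R? : Decidable R) →
             (∀ x → P x → Q x ⊎ R x) → ∀ xs →
             length (filter P? xs) ≤ length (filter Q? xs) + length (filter R? xs)
  filter-∪ P? Q? R? P⊆Q∪R []       = z≤n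
  filter-∪ P? Q? R? P⊆Q∪R (x ∷ xs)
    with ih ← filter-∪ P? Q? R? P⊆Q∪R xs | P? x | Q? x | R? x
  ... | no _  | no _  | no _  = ih
  ... | no _  | no _  | yes _ = ≤-trans ih (+-monoʳ-≤ _ (n≤1+n _))
  ... | no _  | yes _ | no _  = m≤n⇒m≤1+n ih
  ... | no _  | yes _ | yes _ = m≤n⇒m≤1+n (≤-trans ih (+-monoʳ-≤ _ (n≤1+n _)))
  ... | yes p | no ¬q | no ¬r = ⊥-elim ([ ¬q , ¬r ]′ (P⊆Q∪R x p))
  ... | yes _ | no _  | yes _ = ≤-trans (s≤s ih) (≤-reflexive (sym (+-suc _ _)))
  ... | yes _ | yes _ | no _  = s≤s ih
  ... | yes _ | yes _ | yes _ = s≤s (≤-trans ih (+-monoʳ-≤ _ (n≤1+n _)))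

  -- Union bound by induction on the number of sets: `filter-∪` splits off the first one, and
  -- `rest?` decides the union of the others.
  filter-⋃ : ∀ k {P : A → Set} {Q : Fin k → A → Set}
             (P? : Decidable P) (Q? : ∀ j → Decidable (Q j)) →
             (∀ x → P x → ∃[ j ] Q j x) →
             ∀ {m} xs → (∀ j → length (filter (Q? j) xs) ≤ m) →
             length (filter P? xs) ≤ k * m
  filter-⋃ zero    P? Q? P⊆⋃Q []       small = z≤n
  filter-⋃ zero    P? Q? P⊆⋃Q {m} (x ∷ xs) small with P? x
  ... | no _  = filter-⋃ zero P? Q? P⊆⋃Q {m} xs (λ ())
  ... | yes p with () ← proj₁ (P⊆⋃Q x p)
  filter-⋃ (suc k) {P} {Q} P? Q? P⊆⋃Q xs small =
    ≤-trans (filter-∪ P? (Q? zero) rest? split xs)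
            (+-mono-≤ (small zero)
                      (filter-⋃ k rest? (Q? ∘ suc) (λ _ → id) xs (small ∘ suc)))
    where
    rest? = λ x → Fin.any? λ j → Q? (suc j) x

    split : ∀ x → P x → Q zero x ⊎ ∃[ j ] Q (suc j) x
    split x p with P⊆⋃Q x p
    ... | zero  , q = inj₁ q
    ... | suc j , q = inj₂ (j , q)

module _ (I : Instance) where

  Happy-resp : ∀ {c d} → c ≗ d → ∀ {u} → Happy I c u → Happy I d u
  Happy-resp c≗d {u} h v uv = trans (sym (c≗d u)) (trans (h v uv) (c≗d v))

  #happy-cong : ∀ {c d} → c ≗ d → #happy I c ≡ #happy I d
  #happy-cong c≗d =
    cong length (filter-≐ (happy? I _) (happy? I _)
                          (Happy-resp c≗d , Happy-resp (sym ∘ c≗d)) (allFin (n I)))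

  -- fill I i is the case of the constant colouring c = const i.
  override : TotalColouring I → TotalColouring I
  override c v = fromMaybe (c v) (partial I v)

  override-extends : ∀ c → Extends I (override c)
  override-extends c v i eq rewrite eq = refl

  override-fixes : ∀ c → Extends I c → ∀ v → override c v ≡ c v
  override-fixes c ext v with partial I v in eq
  ... | just i  = sym (ext v i eq)
  ... | nothing = refl

  override-cong : ∀ {c d} → c ≗ d → override c ≗ override d
  override-cong c≗d v = cong (λ i → fromMaybe i (partial I v)) (c≗d v)

  fill-agrees : ∀ {c} → Extends I c → ∀ {i} v → c v ≡ i → fill I i v ≡ i
  -- For `i = c v`, the colours `fill I i v` and `override c v` are the same by definition.
  fill-agrees {c} ext v refl = override-fixes c ext v

  fill-happy : ∀ {c} → Extends I c → ∀ u → Happy I c u → Happy I (fill I (c u)) u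
  fill-happy ext u h v uv =
    -- Happiness of `u` gives the neighbour `v` the colour `c u` under `c`, so `fill-agrees` covers
    -- both ends of the edge.
    trans (fill-agrees ext u refl) (sym (fill-agrees ext v (sym (h v uv))))

  #happy-≤-k* : ∀ {m} → (∀ j → #happy I (fill I j) ≤ m) →
                ∀ c → Extends I c → #happy I c ≤ k I * m
  #happy-≤-k* small c ext =
    filter-⋃ (k I) (happy? I c) (λ j → happy? I (fill I j))
             (λ u h → c u , fill-happy ext u h) (allFin (n I)) small

  -- Every `override c` is an extension and every extension is of this form, so the maximum can be
  -- taken over all colourings `c` without filtering. `c₀` is the starting value of `argmax`.
  opt-exists : TotalColouring I → ∃[ opt ] IsOPT I opt
  opt-exists c₀ = score best , (override best , override-extends best , refl) , maximal
    where
    score : TotalColouring I → ℕ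
    score c = #happy I (override c)

    colourings : List (TotalColouring I)
    colourings = map finToFun (allFin (k I ^ n I))

    best : TotalColouring I
    best = argmax score c₀ colourings

    maximal : ∀ c → Extends I c → #happy I c ≤ score best
    maximal c ext = begin
      #happy I c                          ≡⟨ #happy-cong (override-fixes c ext) ⟨
      -- Decoding the code of `c` gives back `c` only pointwise, so congruence of the score is used
      -- in place of an equality of functions.
      score c                             ≡⟨ #happy-cong (override-cong (Fin.finToFun-funToFin c)) ⟨
      score (finToFun (funToFin c))       ≤⟨ All.lookup (f[xs]≤f[argmax] {f = score} c₀ colourings)
                                               (∈-map⁺ finToFun (∈-allFin (funToFin c))) ⟩
      score best                          ∎
      where open ≤-Reasoning

-- `ℚ` keeps fractions in lowest terms, so the comparison is moved to unnormalised fractions, where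
-- it becomes `a ≤ k * b` by cross-multiplication.
1/k*-≤ : ∀ k .{{_ : NonZero k}} {a b} → a ≤ k * b →
         (ℤ.+ 1 ℚ./ k) ℚ.* (ℤ.+ a ℚ./ 1) ℚ.≤ (ℤ.+ b ℚ./ 1)
1/k*-≤ (suc k) {a} {b} a≤kb = ℚ.toℚᵘ-cancel-≤ (begin
  ℚ.toℚᵘ ((ℤ.+ 1 ℚ./ suc k) ℚ.* (ℤ.+ a ℚ./ 1))
    ≃⟨ ℚ.toℚᵘ-homo-* (ℤ.+ 1 ℚ./ suc k) (ℤ.+ a ℚ./ 1) ⟩
  ℚ.toℚᵘ (ℤ.+ 1 ℚ./ suc k) ℚᵘ.* ℚ.toℚᵘ (ℤ.+ a ℚ./ 1)
    ≃⟨ ℚᵘ.*-cong (ℚ.toℚᵘ-fromℚᵘ (mkℚᵘ (ℤ.+ 1) k)) (ℚ.toℚᵘ-fromℚᵘ (mkℚᵘ (ℤ.+ a) 0)) ⟩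
  mkℚᵘ (ℤ.+ 1) k ℚᵘ.* mkℚᵘ (ℤ.+ a) 0
    -- `mkℚᵘ` takes the denominator minus one: `k` and `0` stand for the denominators `suc k` and 1.
    ≤⟨ *≤* (subst₂ ℤ._≤_ (lhs a) (rhs b) (+≤+ a≤kb)) ⟩
  mkℚᵘ (ℤ.+ b) 0
    ≃⟨ ℚ.toℚᵘ-fromℚᵘ (mkℚᵘ (ℤ.+ b) 0) ⟨
  ℚ.toℚᵘ (ℤ.+ b ℚ./ 1) ∎)
  where
  open ℚᵘ.≤-Reasoning

  lhs : ∀ a → ℤ.+ a ≡ (ℤ.+ 1 ℤ.* ℤ.+ a) ℤ.* ℤ.+ 1
  lhs a = sym (trans (ℤ.*-identityʳ _) (ℤ.*-identityˡ _))

  rhs : ∀ b → ℤ.+ (suc k * b) ≡ ℤ.+ b ℤ.* ℤ.+ (suc k * 1)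
  rhs b = trans (cong ℤ.+_ (trans (*-comm (suc k) b) (cong (b *_) (sym (*-identityʳ (suc k))))))
                (ℤ.pos-* b _)

opt-≤-k* : ∀ I {opt m} → IsOPT I opt → (∀ j → #happy I (fill I j) ≤ m) → opt ≤ k I * m
opt-≤-k* I ((c , ext , refl) , _) small = #happy-≤-k* I small c ext

greedyOutput-approximates : ∀ I c → IsGreedyOutput I c → IsApproximateSolution I (1/k I) c
greedyOutput-approximates I c (i , c≗fill , best) =
  (λ v j eq → trans (c≗fill v) (override-extends I (const i) v j eq)) ,
  proj₁ opt , proj₂ opt ,
  1/k*-≤ (k I) (opt-≤-k* I (proj₂ opt)
    λ j → ≤-trans (best j) (≤-reflexive (sym (#happy-cong I c≗fill))))
  where
  opt : ∃[ m ] IsOPT I m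
  opt = opt-exists I c

-- Running time

-- A syntactic criterion: for a concrete array and program it evaluates to a product of unit types,
-- whose proof is inferred.
Untouched : ℕ → Program → Set
Untouched a skip                 = ⊤
Untouched a (b [ d , e ]:= e′)   = T (not (b ≡ᵇ a))
Untouched a (p ⨾ q)              = Untouched a p × Untouched a q
Untouched a (If t Then p Else q) = Untouched a p × Untouched a q
Untouched a (For x < e Do p)     = T (not (x ≡ᵇ a)) × Untouched a p

write-other : ∀ a b → T (not (b ≡ᵇ a)) → ∀ i j m σ x y → write b i j m σ a x y ≡ σ a x y
write-other a b b≢a i j m σ x y with false ← b ≡ᵇ a = refl

run-untouched : ∀ a p {_ : Untouched a p} σ x y → run p σ a x y ≡ σ a x y
run-untouched a skip σ x y = refl
run-untouched a (b [ d , e ]:= e′) {b≢a} σ x y = write-other a b b≢a (⟦ d ⟧ σ) (⟦ e ⟧ σ) (⟦ e′ ⟧ σ) σ x y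
run-untouched a (p ⨾ q) {u , u′} σ x y =
  trans (run-untouched a q {u′} (run p σ) x y) (run-untouched a p {u} σ x y)
run-untouched a (If t Then p Else q) {u , u′} σ x y with ⟦ t ⟧ᵗ σ
... | true  = run-untouched a p {u} σ x y
... | false = run-untouched a q {u′} σ x y
run-untouched a (For z < e Do p) {z≢a , u} σ x y = go (⟦ e ⟧ σ)
  where
  -- Once `e` has the value `m`, the loops with bounds `e` and `lit m` have the same run by
  -- definition; the literal bound allows induction on `m`.
  go : ∀ m → run (For z < lit m Do p) σ a x y ≡ σ a x y
  go zero    = refl
  go (suc m) =
    let τ = run (For z < lit m Do p) σ in
    trans (run-untouched a p {u} (setVar z m τ) x y) (trans (write-other a z z≢a 0 0 m τ x y) (go m))

infixl 6 _⊕_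

_⊕_ : List ℕ → List ℕ → List ℕ
[]       ⊕ bs       = bs
(a ∷ as) ⊕ []       = a ∷ as
(a ∷ as) ⊕ (b ∷ bs) = a + b ∷ as ⊕ bs

evalPoly-⊕ : ∀ as bs x → evalPoly (as ⊕ bs) x ≡ evalPoly as x + evalPoly bs x
evalPoly-⊕ []       bs       x = refl
evalPoly-⊕ (a ∷ as) []       x = sym (+-identityʳ _)
evalPoly-⊕ (a ∷ as) (b ∷ bs) x = begin
  a + b + x * evalPoly (as ⊕ bs) x                     ≡⟨ cong (λ z → a + b + x * z) (evalPoly-⊕ as bs x) ⟩
  a + b + x * (evalPoly as x + evalPoly bs x)          ≡⟨ cong (a + b +_) (*-distribˡ-+ x _ _) ⟩
  a + b + (x * evalPoly as x + x * evalPoly bs x)      ≡⟨ interchange a b _ _ ⟩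
  a + x * evalPoly as x + (b + x * evalPoly bs x)      ∎
  where open ≡-Reasoning

sumBelow-≤ : ∀ m {f b} → (∀ i → f i ≤ b) → sumBelow m f ≤ m * b
sumBelow-≤ zero            f≤b = z≤n
sumBelow-≤ (suc m) {f} {b} f≤b =
  ≤-trans (+-mono-≤ (sumBelow-≤ m f≤b) (f≤b m)) (≤-reflexive (+-comm (m * b) b))

-- With each bound literally `var N` or `var K`, no loop makes more than `size` iterations as long
-- as these two variables keep their values.
InputBoundedLoops : Program → Set
InputBoundedLoops skip                 = ⊤
InputBoundedLoops (b [ d , e ]:= e′)   = ⊤
InputBoundedLoops (p ⨾ q)              = InputBoundedLoops p × InputBoundedLoops q
InputBoundedLoops (If t Then p Else q) = InputBoundedLoops p × InputBoundedLoops q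
InputBoundedLoops (For x < e Do p)     = (e ≡ var N ⊎ e ≡ var K) × InputBoundedLoops p

-- The sum over both branches of a conditional bounds the larger of the two. For a loop, `∷`
-- multiplies the bound for one iteration, including its overhead of 1, by the size.
timePoly : Program → List ℕ
timePoly skip                 = 1 ∷ []
timePoly (a [ d , e ]:= e′)   = 1 + exprTime d + exprTime e + exprTime e′ ∷ []
timePoly (p ⨾ q)              = timePoly p ⊕ timePoly q
timePoly (If t Then p Else q) = (testTime t ∷ []) ⊕ (timePoly p ⊕ timePoly q)
timePoly (For x < e Do p)     = 1 + exprTime e ∷ (1 ∷ []) ⊕ timePoly p

-- As `N` and `K` are never written, the bound on their sum holds in every intermediate store, so
-- the induction can use one fixed `s`.
time-≤ : ∀ p → InputBoundedLoops p → Untouched N p → Untouched K p →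
         ∀ {s} σ → σ N 0 0 + σ K 0 0 ≤ s → time p σ ≤ evalPoly (timePoly p) s
time-≤ skip               _ _ _ σ N+K≤s = m≤m+n _ _
time-≤ (a [ d , e ]:= e′) _ _ _ σ N+K≤s = m≤m+n _ _
time-≤ (p ⨾ q) (bp , bq) (Np , Nq) (Kp , Kq) {s} σ N+K≤s
  rewrite evalPoly-⊕ (timePoly p) (timePoly q) s =
  +-mono-≤ (time-≤ p bp Np Kp σ N+K≤s)
           (time-≤ q bq Nq Kq (run p σ)
             (≤-trans (≤-reflexive (cong₂ _+_ (run-untouched N p {Np} σ 0 0)
                                              (run-untouched K p {Kp} σ 0 0))) N+K≤s))
time-≤ (If t Then p Else q) (bp , bq) (Np , Nq) (Kp , Kq) {s} σ N+K≤s
  rewrite evalPoly-⊕ (testTime t ∷ []) (timePoly p ⊕ timePoly q) s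
        | evalPoly-⊕ (timePoly p) (timePoly q) s =
  +-mono-≤ (m≤m+n _ _) branch
  where
  branch : (if ⟦ t ⟧ᵗ σ then time p σ else time q σ) ≤
           evalPoly (timePoly p) s + evalPoly (timePoly q) s
  branch with ⟦ t ⟧ᵗ σ
  ... | true  = ≤-trans (time-≤ p bp Np Kp σ N+K≤s) (m≤m+n _ _)
  ... | false = ≤-trans (time-≤ q bq Nq Kq σ N+K≤s) (m≤n+m _ _)
time-≤ (For x < e Do p) (be , bp) (x≢N , Np) (x≢K , Kp) {s} σ N+K≤s
  rewrite evalPoly-⊕ (1 ∷ []) (timePoly p) s =
  +-monoʳ-≤ (1 + exprTime e)
    (≤-trans (sumBelow-≤ (⟦ e ⟧ σ) (λ i → +-mono-≤ (m≤m+n _ _) (time-≤ p bp Np Kp _ (N+K≤s′ i))))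
             (*-monoˡ-≤ _ (e≤s be)))
  where
  e≤s : e ≡ var N ⊎ e ≡ var K → ⟦ e ⟧ σ ≤ s
  e≤s (inj₁ refl) = ≤-trans (m≤m+n _ _) N+K≤s
  e≤s (inj₂ refl) = ≤-trans (m≤n+m _ _) N+K≤s

  -- The state in which iteration i starts is itself reached by a program, so
  -- that run-untouched applies to it; likewise in the loops below.
  before : ℕ → Program
  before i = (For x < lit i Do p) ⨾ x := lit i

  N+K≤s′ : ∀ i → run (before i) σ N 0 0 + run (before i) σ K 0 0 ≤ s
  N+K≤s′ i = ≤-trans (≤-reflexive (cong₂ _+_ (run-untouched N (before i) {(x≢N , Np) , x≢N} σ 0 0)
                                             (run-untouched K (before i) {(x≢K , Kp) , x≢K} σ 0 0))) N+K≤s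

greedyMHV-polynomial : RunsInPolynomialTime greedyMHV
greedyMHV-polynomial =
  timePoly greedyMHV , λ I → time-≤ greedyMHV loops _ _ (encode I) ≤-refl
  where
  loops : InputBoundedLoops greedyMHV
  loops = _ , _ ,
    (inj₂ refl , (inj₁ refl , _) , (_ , inj₁ refl , _ , (inj₁ refl , _) , _) , _) ,
    inj₁ refl , _

-- Correctness of the program

≡ᵇ-refl : ∀ m → (m ≡ᵇ m) ≡ true
≡ᵇ-refl zero    = refl
≡ᵇ-refl (suc m) = ≡ᵇ-refl m

<⇒≡ᵇ-false : ∀ {m n} → m < n → (n ≡ᵇ m) ≡ false
<⇒≡ᵇ-false {zero}  {suc n} _           = refl
<⇒≡ᵇ-false {suc m} {suc n} (s≤s m<n) = <⇒≡ᵇ-false m<n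

array-toℕ : ∀ {n} (f : Fin n → ℕ) v → array f (toℕ v) ≡ f v
array-toℕ f zero    = refl
array-toℕ f (suc v) = array-toℕ (f ∘ suc) v

-- The facts about the input that the stages below read off the store. `K` is absent: the outer loop
-- evaluates it once, right after initialisation, where it reduces to `k I`.
record HoldsInput (I : Instance) (σ : Store) : Set where
  field
    order     : σ N 0 0 ≡ n I
    adjacency : ∀ u v → σ ADJ (toℕ u) (toℕ v) ≡ (if adj I u v then 1 else 0)
    colours   : ∀ v → σ COL (toℕ v) 0 ≡ maybe′ colourCode 0 (partial I v)

open HoldsInput

encode-holds : ∀ I → HoldsInput I (encode I)
encode-holds I = record
  { order     = refl
  ; adjacency = λ u v → trans
      (array-toℕ (λ u → array (λ v → if adj I u v then 1 else 0) (toℕ v)) u)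
      (array-toℕ (λ v → if adj I u v then 1 else 0) v)
  ; colours   = array-toℕ _
  }

run-holds : ∀ {I} p {_ : Untouched N p} {_ : Untouched ADJ p} {_ : Untouched COL p} {σ} →
            HoldsInput I σ → HoldsInput I (run p σ)
run-holds p {uN} {uA} {uC} {σ} h = record
  { order     = trans (run-untouched N p {uN} σ 0 0) (order h)
  ; adjacency = λ u v → trans (run-untouched ADJ p {uA} σ _ _) (adjacency h u v)
  ; colours   = λ v → trans (run-untouched COL p {uC} σ _ _) (colours h v)
  }

-- Filling in a colour

module FillInto (dst b : ℕ) where

  body : Program
  body =
    If COL [ var U ] == lit 0
    Then dst [ var U ]:= succ (var b)
    Else dst [ var U ]:= COL [ var U ]

  filled : Store → ℕ → ℕ
  filled σ x = if σ COL x 0 ≡ᵇ 0 then suc (σ b 0 0) else σ COL x 0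

  run-body : ∀ σ → run body σ ≡ write dst (σ U 0 0) 0 (filled σ (σ U 0 0)) σ
  run-body σ with σ COL (σ U 0 0) 0 ≡ᵇ 0
  ... | true  = refl
  ... | false = refl

  module _ (uC : Untouched COL (fillInto dst (var b)))
           (ub : Untouched b (fillInto dst (var b)))
           (U≢dst : T (not (U ≡ᵇ dst))) (σ : Store) where

    -- Entry `x` is written in iteration `x` and kept by all later ones, which write elsewhere. The
    -- value written is that of the initial store because the loop changes neither `COL` nor `b`.
    run-loop : ∀ m x → x < m → run (For U < lit m Do body) σ dst x 0 ≡ filled σ x
    run-loop (suc m) x x<1+m
      rewrite run-body (setVar U m (run (For U < lit m Do body) σ))
            | ≡ᵇ-refl dst
      with m<1+n⇒m<n∨m≡n x<1+m
    ... | inj₁ x<m rewrite <⇒≡ᵇ-false x<m =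
      trans (write-other dst U U≢dst 0 0 m (run (For U < lit m Do body) σ) x 0) (run-loop m x x<m)
    ... | inj₂ refl rewrite ≡ᵇ-refl m =
      cong₂ (λ a c → if a ≡ᵇ 0 then suc c else a)
            (run-untouched COL before {uC , _} σ m 0)
            (run-untouched b before {ub , proj₁ ub} σ 0 0)
      where
      before : Program
      before = (For U < lit m Do body) ⨾ U := lit m

    fillInto-correct : ∀ {I} → HoldsInput I σ → ∀ i → σ b 0 0 ≡ toℕ i → ∀ v →
                       run (fillInto dst (var b)) σ dst (toℕ v) 0 ≡ colourCode (fill I i v)
    fillInto-correct {I} h i b≡i v
      rewrite order h | run-loop (n I) (toℕ v) (Fin.toℕ<n v) | colours h v | b≡i
      with partial I v
    ... | just _  = refl
    ... | nothing = refl

open FillInto using (fillInto-correct)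

-- Counting the happy vertices

allBelow : ℕ → (ℕ → Bool) → Bool
allBelow zero    f = true
-- The last index comes first, to match the last iteration of a loop.
allBelow (suc m) f = f m ∧ allBelow m f

allBelow-cong : ∀ m {f g} → (∀ i → f i ≡ g i) → allBelow m f ≡ allBelow m g
allBelow-cong zero    f≗g = refl
allBelow-cong (suc m) f≗g = cong₂ _∧_ (f≗g m) (allBelow-cong m f≗g)

T-allBelow : ∀ m {f} → T (allBelow m f) ⇔ (∀ i → i < m → T (f i))
T-allBelow m = mk⇔ (to m) (from m)
  where
  to : ∀ m {f} → T (allBelow m f) → ∀ i → i < m → T (f i)
  to (suc m) t i i<1+m with f , all ← Equivalence.to T-∧ t | m<1+n⇒m<n∨m≡n i<1+m
  ... | inj₁ i<m  = to m all i i<m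
  ... | inj₂ refl = f

  from : ∀ m {f} → (∀ i → i < m → T (f i)) → T (allBelow m f)
  from zero    all = _
  from (suc m) all = Equivalence.from T-∧ (all m ≤-refl , from m (λ i i<m → all i (m<n⇒m<1+n i<m)))

-- The implication that `Happy` demands of one pair of vertices, as a Boolean read off the store.
agrees : Store → ℕ → ℕ → Bool
agrees σ u w = not (σ ADJ u w ≡ᵇ 1) ∨ (σ CUR u 0 ≡ᵇ σ CUR w 0)

satisfied : Store → ℕ → ℕ
satisfied σ u = if allBelow (σ N 0 0) (agrees σ u) then 1 else 0

checkEdge : Program
checkEdge =
  If _[_,_] ADJ (var U) (var W) == lit 1
  Then (If CUR [ var U ] == CUR [ var W ]
        Then skip
        Else FLAG := lit 0)
  Else skip

checkEdge-FLAG : ∀ σ → run checkEdge σ FLAG 0 0 ≡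
                 (if agrees σ (σ U 0 0) (σ W 0 0) then σ FLAG 0 0 else 0)
checkEdge-FLAG σ with σ ADJ (σ U 0 0) (σ W 0 0) ≡ᵇ 1
... | false = refl
... | true  with σ CUR (σ U 0 0) 0 ≡ᵇ σ CUR (σ W 0 0) 0
...   | true  = refl
...   | false = refl

-- No iteration raises `FLAG`, so a single disagreeing pair settles it. The rewrites show that the
-- earlier iterations left alone whatever iteration `m` reads.
checkEdges-FLAG : ∀ m σ → run (For W < lit m Do checkEdge) σ FLAG 0 0 ≡
                  (if allBelow m (agrees σ (σ U 0 0)) then σ FLAG 0 0 else 0)
checkEdges-FLAG zero    σ = refl
checkEdges-FLAG (suc m) σ
  rewrite checkEdge-FLAG (setVar W m (run (For W < lit m Do checkEdge) σ))
        | run-untouched U (For W < lit m Do checkEdge) σ 0 0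
        | run-untouched ADJ (For W < lit m Do checkEdge) σ (σ U 0 0) m
        | run-untouched CUR (For W < lit m Do checkEdge) σ (σ U 0 0) 0
        | run-untouched CUR (For W < lit m Do checkEdge) σ m 0
        | checkEdges-FLAG m σ
  with agrees σ (σ U 0 0) m
... | true  = refl
... | false = refl

countIfFlagged : Program
countIfFlagged =
  If var FLAG == lit 1
  Then COUNT := succ (var COUNT)
  Else skip

checkVertex : Program
checkVertex = FLAG := lit 1 ⨾ (For W < var N Do checkEdge) ⨾ countIfFlagged

countIfFlagged-COUNT : ∀ b σ → σ FLAG 0 0 ≡ (if b then 1 else 0) →
                       run countIfFlagged σ COUNT 0 0 ≡ (if b then 1 else 0) + σ COUNT 0 0
countIfFlagged-COUNT true  σ eq rewrite eq = refl
countIfFlagged-COUNT false σ eq rewrite eq = refl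

checkVertex-COUNT : ∀ σ → run checkVertex σ COUNT 0 0 ≡ satisfied σ (σ U 0 0) + σ COUNT 0 0
checkVertex-COUNT σ =
  trans (countIfFlagged-COUNT (allBelow (σ N 0 0) (agrees σ (σ U 0 0))) (run checkEdges σ₁)
          (checkEdges-FLAG (σ N 0 0) σ₁))
        (cong (satisfied σ (σ U 0 0) +_) (run-untouched COUNT checkEdges σ₁ 0 0))
  where
  checkEdges = For W < var N Do checkEdge
  σ₁ = setVar FLAG 1 σ

-- Checking vertices changes the store but not what `satisfied` reads, so the contributions of all
-- iterations can be expressed in the initial store.
satisfied-cong : ∀ σ τ → σ N 0 0 ≡ τ N 0 0 → (∀ x y → σ ADJ x y ≡ τ ADJ x y) →
                 (∀ x → σ CUR x 0 ≡ τ CUR x 0) → ∀ u → satisfied σ u ≡ satisfied τ u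
satisfied-cong σ τ eqN eqADJ eqCUR u rewrite eqN =
  cong (if_then 1 else 0) (allBelow-cong (τ N 0 0) λ w →
    cong₂ (λ a b → not (a ≡ᵇ 1) ∨ b) (eqADJ u w) (cong₂ _≡ᵇ_ (eqCUR u) (eqCUR w)))

checkVertices-COUNT : ∀ m σ → run (For U < lit m Do checkVertex) σ COUNT 0 0 ≡
                      sumBelow m (satisfied σ) + σ COUNT 0 0
checkVertices-COUNT zero    σ = refl
checkVertices-COUNT (suc m) σ = begin
  run checkVertex (setVar U m τ) COUNT 0 0           ≡⟨ checkVertex-COUNT (setVar U m τ) ⟩
  satisfied τ m + τ COUNT 0 0                        ≡⟨ cong₂ _+_ τ≈σ (checkVertices-COUNT m σ) ⟩
  satisfied σ m + (sumBelow m (satisfied σ) + c)     ≡⟨ +-assoc (satisfied σ m) _ c ⟨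
  satisfied σ m + sumBelow m (satisfied σ) + c       ≡⟨ cong (_+ c) (+-comm (satisfied σ m) _) ⟩
  sumBelow m (satisfied σ) + satisfied σ m + c       ∎
  where
  open ≡-Reasoning
  loop = For U < lit m Do checkVertex
  τ = run loop σ
  c = σ COUNT 0 0

  τ≈σ : satisfied τ m ≡ satisfied σ m
  τ≈σ = satisfied-cong τ σ (run-untouched N loop σ 0 0) (run-untouched ADJ loop σ)
                       (λ x → run-untouched CUR loop σ x 0) m

-- `sumBelow` splits off its last term and `tabulate` its first; this reconciles the two recursions.
sumBelow-suc : ∀ m f → sumBelow (suc m) f ≡ f 0 + sumBelow m (f ∘ suc)
sumBelow-suc zero    f = sym (+-identityʳ (f 0))
sumBelow-suc (suc m) f =
  trans (cong (_+ f (suc m)) (sumBelow-suc m f)) (+-assoc (f 0) _ _)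

length-filter-tabulate : ∀ {A : Set} {P : A → Set} (P? : Decidable P) m (f : Fin m → A) {g} →
                         (∀ v → g (toℕ v) ≡ (if does (P? (f v)) then 1 else 0)) →
                         sumBelow m g ≡ length (filter P? (tabulate f))
length-filter-tabulate P? zero    f         g≗ = refl
length-filter-tabulate P? (suc m) f {g} g≗
  rewrite sumBelow-suc m g | g≗ zero | length-filter-tabulate P? m (f ∘ suc) {g ∘ suc} (g≗ ∘ suc)
  with does (P? (f zero))
... | true  = refl
... | false = refl

module _ {I : Instance} {σ : Store} (h : HoldsInput I σ) {c : TotalColouring I}
         (cur : ∀ v → σ CUR (toℕ v) 0 ≡ colourCode (c v)) where

  T-agrees : ∀ u v → T (agrees σ (toℕ u) (toℕ v)) ⇔ (T (adj I u v) → c u ≡ c v)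
  T-agrees u v rewrite adjacency h u v | cur u | cur v with adj I u v
  ... | true  = mk⇔ (λ t _ → Fin.toℕ-injective (≡ᵇ⇒≡ _ _ t)) (λ eq → ≡⇒≡ᵇ _ _ (cong toℕ (eq _)))
  ... | false = mk⇔ (λ _ ()) _

  T-allBelow-agrees : ∀ u → T (allBelow (n I) (agrees σ (toℕ u))) ⇔ Happy I c u
  T-allBelow-agrees u = mk⇔
    (λ t v → Equivalence.to (T-agrees u v)
               (Equivalence.to (T-allBelow (n I)) t (toℕ v) (Fin.toℕ<n v)))
    (λ happy → Equivalence.from (T-allBelow (n I)) λ i i<n →
       subst (T ∘ agrees σ (toℕ u)) (Fin.toℕ-fromℕ< i<n)
             (Equivalence.from (T-agrees u (fromℕ< i<n)) (happy _)))

  satisfied-toℕ : ∀ u → satisfied σ (toℕ u) ≡ (if does (happy? I c u) then 1 else 0)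
  satisfied-toℕ u rewrite order h =
    cong (if_then 1 else 0)
         -- `does (T? b)` is `b` itself, so the equivalence of propositions becomes an equality of
         -- Booleans.
         (does-⇔ (T-allBelow-agrees u) (T? (allBelow (n I) (agrees σ (toℕ u)))) (happy? I c u))

  countHappy-correct : run countHappy σ COUNT 0 0 ≡ #happy I c
  countHappy-correct = begin
    run countHappy σ COUNT 0 0             ≡⟨ checkVertices-COUNT (σ N 0 0) (setVar COUNT 0 σ) ⟩
    sumBelow (σ N 0 0) (satisfied σ) + 0   ≡⟨ +-identityʳ _ ⟩
    sumBelow (σ N 0 0) (satisfied σ)       ≡⟨ cong (λ m → sumBelow m (satisfied σ)) (order h) ⟩
    sumBelow (n I) (satisfied σ)           ≡⟨ length-filter-tabulate (happy? I c) (n I) id satisfied-toℕ ⟩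
    #happy I c                             ∎
    where open ≡-Reasoning

-- The search for the best colour

keepBetter : Program
keepBetter =
  If var BEST <= var COUNT
  Then (BEST := var COUNT ⨾
        BESTCOLOUR := var I′)
  Else skip

tryColour : Program
tryColour = fillInto CUR (var I′) ⨾ countHappy ⨾ keepBetter

module _ (I : Instance) where

  score : Fin (k I) → ℕ
  score i = #happy I (fill I i)

  -- The state of the search after m colours; as no colour has been recorded
  -- before the first step, m = 0 is set apart.
  Leading : ℕ → ℕ → ℕ → Set
  Leading m best colour =
    (∀ j → toℕ j < m → score j ≤ best) ×
    (m ≡ 0 × best ≡ 0 ⊎ ∃[ i ] colour ≡ toℕ i × best ≡ score i)

  keepBetter-leading : ∀ τ i → τ I′ 0 0 ≡ toℕ i → τ COUNT 0 0 ≡ score i →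
                       Leading (toℕ i) (τ BEST 0 0) (τ BESTCOLOUR 0 0) →
                       let τ′ = run keepBetter τ in
                       Leading (suc (toℕ i)) (τ′ BEST 0 0) (τ′ BESTCOLOUR 0 0)
  keepBetter-leading τ i I′≡i COUNT≡ (max , best) with τ BEST 0 0 ≤ᵇ τ COUNT 0 0 in eq
  ... | true  = max′ , inj₂ (i , I′≡i , COUNT≡)
    where
    max′ : ∀ j → toℕ j < suc (toℕ i) → score j ≤ τ COUNT 0 0
    max′ j j<1+i with m<1+n⇒m<n∨m≡n j<1+i
    ... | inj₁ j<i = ≤-trans (max j j<i) (≤ᵇ⇒≤ _ _ (subst T (sym eq) _))
    ... | inj₂ j≡i rewrite Fin.toℕ-injective j≡i = ≤-reflexive (sym COUNT≡)
  ... | false = max′ , best′ best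
    where
    worse : τ COUNT 0 0 < τ BEST 0 0
    worse = ≰⇒> (subst T eq ∘ ≤⇒≤ᵇ)

    max′ : ∀ j → toℕ j < suc (toℕ i) → score j ≤ τ BEST 0 0
    max′ j j<1+i with m<1+n⇒m<n∨m≡n j<1+i
    ... | inj₁ j<i = max j j<i
    ... | inj₂ j≡i rewrite Fin.toℕ-injective j≡i =
      ≤-trans (≤-reflexive (sym COUNT≡)) (<⇒≤ worse)

    best′ : ∀ {m} → m ≡ 0 × τ BEST 0 0 ≡ 0 ⊎ _ → suc m ≡ 0 × τ BEST 0 0 ≡ 0 ⊎ _
    -- Here the test must be non-strict: while `BEST` is still 0, the first colour passes it even if
    -- it makes no vertex happy.
    best′ (inj₁ (_ , BEST≡0)) = contradiction (subst (τ COUNT 0 0 <_) BEST≡0 worse) λ ()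
    best′ (inj₂ b)            = inj₂ b

  -- The counter `m` and the colour `i` are kept apart because the loop counts in natural numbers;
  -- `fromℕ<` later supplies the colour.
  tryColour-leading : ∀ {m} σ → HoldsInput I σ → ∀ (i : Fin (k I)) → toℕ i ≡ m → σ I′ 0 0 ≡ m →
                      Leading m (σ BEST 0 0) (σ BESTCOLOUR 0 0) →
                      let σ′ = run tryColour σ in
                      Leading (suc m) (σ′ BEST 0 0) (σ′ BESTCOLOUR 0 0)
  tryColour-leading σ h i refl I′≡i leading =
    keepBetter-leading (run evaluate σ) i
      (trans (run-untouched I′ evaluate σ 0 0) I′≡i)
      (countHappy-correct (run-holds (fillInto CUR (var I′)) h)
                          (fillInto-correct CUR I′ _ _ _ σ h i I′≡i))
      (subst₂ (Leading (toℕ i)) (sym (run-untouched BEST evaluate σ 0 0))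
              (sym (run-untouched BESTCOLOUR evaluate σ 0 0)) leading)
    where
    evaluate : Program
    evaluate = fillInto CUR (var I′) ⨾ countHappy

  tryColours-leading : ∀ m → m ≤ k I → ∀ σ → HoldsInput I σ →
                       Leading 0 (σ BEST 0 0) (σ BESTCOLOUR 0 0) →
                       let σ′ = run (For I′ < lit m Do tryColour) σ in
                       Leading m (σ′ BEST 0 0) (σ′ BESTCOLOUR 0 0)
  tryColours-leading zero    m≤k σ h leading = leading
  tryColours-leading (suc m) m<k σ h leading =
    tryColour-leading (run before σ) (run-holds before h) (fromℕ< m<k) (Fin.toℕ-fromℕ< m<k) refl
      (tryColours-leading m (<⇒≤ m<k) σ h leading)
    where
    before : Program
    before = (For I′ < lit m Do tryColour) ⨾ I′ := lit m

  greedyMHV-outputs : ∃[ i ] Outputs greedyMHV I (fill I i) × (∀ j → score j ≤ score i)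
  greedyMHV-outputs with tryColours-leading (k I) ≤-refl _ (run-holds initialise (encode-holds I))
                           ((λ _ ()) , inj₁ (refl , refl))
    where
    initialise : Program
    initialise = BEST := lit 0 ⨾ BESTCOLOUR := lit 0
  -- A search that recorded no colour would have run for `k I = 0` steps.
  ... | max , inj₁ (k≡0 , _) = contradiction k≡0 (≢-nonZero⁻¹ (k I))
  ... | max , inj₂ (i , BESTCOLOUR≡i , BEST≡) =
    i , fillInto-correct OUT BESTCOLOUR _ _ _ _ (run-holds search (encode-holds I)) i BESTCOLOUR≡i
      , λ j → ≤-trans (max j (Fin.toℕ<n j)) (≤-reflexive BEST≡)
    where
    search : Program
    search = BEST := lit 0 ⨾ BESTCOLOUR := lit 0 ⨾ (For I′ < var K Do tryColour)

  -- Transfers the greedy property from the colouring `fill I i` found above to any colouring that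
  -- the program outputs.
  outputs-unique : ∀ {p c d} → Outputs p I c → Outputs p I d → c ≗ d
  outputs-unique out out′ v =
    Fin.toℕ-injective (suc-injective (trans (sym (out v)) (out′ v)))

theorem2p2 : IsApproximationAlgorithm 1/k greedyMHV
    × (∀ I c′ → Outputs greedyMHV I c′ → IsGreedyOutput I c′)
    × (∀ I c′ → IsGreedyOutput I c′ → IsApproximateSolution I (1/k I) c′)
theorem2p2 =
  (greedyMHV-polynomial , λ I → let i , out , best = greedyMHV-outputs I in
     fill I i , out , greedyOutput-approximates I (fill I i) (i , (λ _ → refl) , best)) ,
  (λ I c′ out → let i , out-fill , best = greedyMHV-outputs I in
     i , outputs-unique I {greedyMHV} out out-fill , best) ,
  greedyOutput-approximates
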